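{- There exist arbitrarily long steady words over a $4$-letter alphabet; that is, for every $n\ge 1$ there is a steady word of length at least $n$ over the alphabet $\{\mathtt{1},\mathtt{2},\mathtt{3},\mathtt{4}\}$.
   Context: A word is a finite sequence of letters from an alphabet. A factor of a word $W$ is a contiguous subword, i.e. $W=PUS$ with $P,S$ possibly empty. A square is a nonempty word of the form $XX$. A word is square-free if it has no factor that is a square. A square-free word $W$ is steady if every word obtained from $W$ by deleting exactly one letter (at any position, including the first and last) is square-free. -}

module Defs where

open import Data.Fin.Base using (Fin)
open import Data.List.Base using (List; []; _++_; length; removeAt)
open import Data.Product.Base using (∃-syntax; _×_)
open import Level using (Level)
open import Relation.Binary.PropositionalEquality.Core using (_≡_; _≢_)
open import Relation.Nullary.Negation.Core using (¬_)

private
  variable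
    a : Level

Word : Set a → Set a
Word = List

_IsFactorOf_ : {A : Set a} → Word A → Word A → Set a
U IsFactorOf W = ∃[ P ] ∃[ S ] W ≡ P ++ U ++ S

IsSquare : {A : Set a} → Word A → Set a
IsSquare U = ∃[ X ] (X ≢ [] × U ≡ X ++ X)

SquareFree : {A : Set a} → Word A → Set a
SquareFree W = ∀ U → U IsFactorOf W → ¬ IsSquare U

Steady : {A : Set a} → Word A → Set a
Steady W = SquareFree W × (∀ (i : Fin (length W)) → SquareFree (removeAt W i))

{-# OPTIONS --safe #-}

-- The steady words are the prefixes of the fixed point w of a 50-uniform morphism on four
-- letters, found by computer search. Deleting a letter creates a square exactly when w has a
-- factor X₁ a X₂ X₁ X₂ or X₁ X₂ X₁ a X₂; in both cases one of X₁, X₂ recurs at distance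
-- p = |X₁ X₂| and the other at distance p + 1. A factor of length 13 determines its position
-- in w modulo 50, so X₁ and X₂ cannot both be that long. If exactly one of them is, its
-- distance is a multiple of 50 and its two occurrences almost touch; reading w only at
-- positions congruent to 17 or to 32, where the letter determines the block, yields a square
-- in w of a smaller period, and w is square-free by the same descent. If neither is, the
-- factor lies inside the image of two consecutive letters, which is a finite check.
module Submission where

open import Defs
open import Data.Fin.Base using (Fin; zero; suc; toℕ)
open import Data.Fin.Patterns using (0F; 1F; 2F; 3F)
import Data.Fin.Properties as Fin
open import Data.Fin.Properties using (all?)
open import Data.List.Base using ([]; _∷_; _++_; length; drop; applyUpTo; removeAt)
open import Data.List.Properties using (∷-injectiveˡ; ∷-injectiveʳ; length-applyUpTo; ++-assoc)
open import Data.Nat.Base using (ℕ; zero; suc; pred; _+_; _*_; _∸_; _/_; _%_; _≤_; _<_; _≥_; z≤n; s≤s; z<s; s<s; NonZero; >-nonZero)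
open import Data.Nat.Divisibility using (_∣_; divides; ∣1⇒≡1; ∣m+n∣m⇒∣n)
open import Data.Nat.DivMod using (m≡m%n+[m/n]*n; m%n<n; m/n<m; m/n≤m; [m+kn]%n≡m%n; m<n⇒m%n≡m; m<n⇒m/n≡0; +-distrib-/-∣ʳ; m*n/n≡m)
open import Data.Nat.Induction using (<-rec)
open import Data.Nat.Properties
open import Data.Nat.Tactic.RingSolver using (solve-∀)
open import Data.Product.Base using (Σ-syntax; ∃-syntax; _×_; _,_)
open import Function.Base using (_∘_)
open import Relation.Binary.Definitions using (DecidableEquality; tri<; tri≈; tri>)
open import Relation.Binary.PropositionalEquality
open import Relation.Nullary using (¬_; Dec; yes; no; contradiction)
open import Relation.Nullary.Decidable using (map′; ¬?; _×-dec_; _→-dec_; toWitness; from-yes)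

-- Repetitions and near-squares in infinite words

module _ {A : Set} where

  shift : ℕ → (ℕ → A) → ℕ → A
  shift n f j = f (n + j)

  Agree : (ℕ → A) → (ℕ → A) → ℕ → Set
  Agree f g m = ∀ j → j < m → f j ≡ g j

  -- `d` is the distance and `m` the length of the recurring factor; `d ≡ m` is a square, `m < d`
  -- leaves a gap of `d ∸ m` letters.
  Repeats : (ℕ → A) → ℕ → ℕ → Set
  Repeats f d m = Agree f (shift d f) m

  -- The factors X₁ a X₂ X₁ X₂ (resp. X₁ X₂ X₁ a X₂) with |X₁| = s and |X₂| = t:
  -- deleting the letter a leaves a square. For t = 0 the second is just a square X₁ X₁.
  NearSquareˡ NearSquareʳ : (ℕ → A) → ℕ → ℕ → Set
  NearSquareˡ f s t = Repeats f (suc (s + t)) s × Repeats (shift (suc s) f) (s + t) t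
  NearSquareʳ f s t = Repeats f (s + t) s × Repeats (shift s f) (suc (s + t)) t

  repeats-local : ∀ {f g : ℕ → A} u {d m N} → Agree f g N → u + (d + m) ≤ N →
                  Repeats (shift u f) d m → Repeats (shift u g) d m
  repeats-local {f} {g} u {d} {m} {N} f≈g bound rep j j<m = begin
    g (u + j)        ≡⟨ f≈g (u + j) (<-≤-trans (+-monoʳ-< u (<-≤-trans j<m (m≤n+m m d))) bound) ⟨
    f (u + j)        ≡⟨ rep j j<m ⟩
    f (u + (d + j))  ≡⟨ f≈g (u + (d + j)) (<-≤-trans (+-monoʳ-< u (+-monoʳ-< d j<m)) bound) ⟩
    g (u + (d + j))  ∎
    where open ≡-Reasoning

  repeats-shift : ∀ (f : ℕ → A) i u d {m} → Repeats (shift u (shift i f)) d m → Repeats (shift (i + u) f) d m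
  repeats-shift f i u d rep j j<m =
    trans (cong f (+-assoc i u j)) (trans (rep j j<m) (cong f (sym (+-assoc i u (d + j)))))

  -- The bound on the agreement is the full length of the factor: two copies of `s + t` letters and
  -- the deleted one.
  nearSquareˡ-local : ∀ {f g : ℕ → A} s t → Agree f g (suc (s + t + (s + t))) →
                      NearSquareˡ f s t → NearSquareˡ g s t
  nearSquareˡ-local s t f≈g (rep₁ , rep₂) =
    repeats-local 0 f≈g (s≤s (+-monoʳ-≤ (s + t) (m≤m+n s t))) rep₁ ,
    repeats-local (suc s) f≈g (≤-reflexive (cong suc (eq s t))) rep₂
    where
    eq : ∀ s t → s + (s + t + t) ≡ s + t + (s + t)
    eq = solve-∀

  nearSquareʳ-local : ∀ {f g : ℕ → A} s t → Agree f g (suc (s + t + (s + t))) →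
                      NearSquareʳ f s t → NearSquareʳ g s t
  nearSquareʳ-local s t f≈g (rep₁ , rep₂) =
    repeats-local 0 f≈g (m≤n⇒m≤1+n (+-monoʳ-≤ (s + t) (m≤m+n s t))) rep₁ ,
    repeats-local s f≈g (≤-reflexive (eq s t)) rep₂
    where
    eq : ∀ s t → s + suc (s + t + t) ≡ suc (s + t + (s + t))
    eq = solve-∀

  -- Positions beyond the end of the word carry the junk letter e.
  at : A → Word A → ℕ → A
  at e []       _       = e
  at e (x ∷ xs) zero    = x
  at e (x ∷ xs) (suc n) = at e xs n

  at-drop : ∀ e n xs j → at e (drop n xs) j ≡ at e xs (n + j)
  at-drop e zero    xs       j = refl
  at-drop e (suc n) []       j = refl
  at-drop e (suc n) (x ∷ xs) j = at-drop e n xs j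

  at-++ˡ : ∀ e xs ys {j} → j < length xs → at e (xs ++ ys) j ≡ at e xs j
  at-++ˡ e (x ∷ xs) ys {zero}  _       = refl
  at-++ˡ e (x ∷ xs) ys {suc j} (s≤s j<) = at-++ˡ e xs ys j<

  at-++ʳ : ∀ e xs ys j → at e (xs ++ ys) (length xs + j) ≡ at e ys j
  at-++ʳ e []       ys j = refl
  at-++ʳ e (x ∷ xs) ys j = at-++ʳ e xs ys j

-- Deleting a letter

-- The enumeration of ℕ without e.
skip : ℕ → ℕ → ℕ
skip zero    j       = suc j
skip (suc e) zero    = zero
skip (suc e) (suc j) = suc (skip e j)

skip-< : ∀ {e j} → j < e → skip e j ≡ j
skip-< {suc e} {zero}  _         = refl
skip-< {suc e} {suc j} (s≤s j<e) = cong suc (skip-< j<e)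

skip-≥ : ∀ {e j} → e ≤ j → skip e j ≡ suc j
skip-≥ {zero}          _         = refl
skip-≥ {suc e} {suc j} (s≤s e≤j) = cong suc (skip-≥ e≤j)

module _ {A : Set} where

  removeAt-applyUpTo : ∀ (f : ℕ → A) n (i : Fin (length (applyUpTo f n))) →
                       removeAt (applyUpTo f n) i ≡ applyUpTo (f ∘ skip (toℕ i)) (pred n)
  removeAt-applyUpTo f (suc n)       zero    = refl
  removeAt-applyUpTo f (suc (suc n)) (suc i) = cong (f 0 ∷_) (removeAt-applyUpTo (f ∘ suc) (suc n) i)

  applyUpTo-suffix : ∀ (f : ℕ → A) n P {Y} → applyUpTo f n ≡ P ++ Y →
                     applyUpTo (shift (length P) f) (n ∸ length P) ≡ Y
  applyUpTo-suffix f n       []      eq = eq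
  applyUpTo-suffix f (suc n) (_ ∷ P) eq = applyUpTo-suffix (f ∘ suc) n P (∷-injectiveʳ eq)

  applyUpTo-agree : ∀ (f g : ℕ → A) m n X {Y Z} → applyUpTo f m ≡ X ++ Y → applyUpTo g n ≡ X ++ Z →
                    Agree f g (length X)
  applyUpTo-agree f g (suc m) (suc n) (_ ∷ X) eqf eqg zero    _ =
    trans (∷-injectiveˡ eqf) (sym (∷-injectiveˡ eqg))
  applyUpTo-agree f g (suc m) (suc n) (_ ∷ X) eqf eqg (suc j) (s≤s j<) =
    applyUpTo-agree (f ∘ suc) (g ∘ suc) m n X (∷-injectiveʳ eqf) (∷-injectiveʳ eqg) j j<

  -- Kept general in `f` so that it serves both the infinite word and the word with one letter
  -- deleted.
  squareFree-applyUpTo : ∀ {f : ℕ → A} → (∀ i {p} → 0 < p → ¬ Repeats (shift i f) p p) →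
                         ∀ n → SquareFree (applyUpTo f n)
  squareFree-applyUpTo noSquare n _ (P , S , eq) ([] , X≢[] , refl) = X≢[] refl
  squareFree-applyUpTo {f} noSquare n _ (P , S , eq) (X@(_ ∷ _) , _ , refl) =
    noSquare (length P) z<s
      (applyUpTo-agree _ _ _ _ X first (applyUpTo-suffix _ _ X first))
    where
    first : applyUpTo (shift (length P) f) (n ∸ length P) ≡ X ++ X ++ S
    first = trans (applyUpTo-suffix f n P eq) (++-assoc X X S)

  -- The deleted letter falls after `s` letters of the first half. The rest of that half and the
  -- whole second half lie one place further right in `f`, so distances starting left of the gap
  -- grow by one.
  skip-first : ∀ (f : ℕ → A) i s t → Repeats (shift i (f ∘ skip (i + s))) (s + t) (s + t) →
               NearSquareˡ (shift i f) s t
  skip-first f i s t rep = rep₁ , rep₂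
    where
    open ≡-Reasoning
    after : ∀ j → s ≤ j → f (skip (i + s) (i + j)) ≡ f (i + suc j)
    after j s≤j = cong f (trans (skip-≥ (+-monoʳ-≤ i s≤j)) (sym (+-suc i j)))
    rep₁ : Repeats (shift i f) (suc (s + t)) s
    rep₁ j j<s = begin
      f (i + j)                         ≡⟨ cong f (skip-< (+-monoʳ-< i j<s)) ⟨
      f (skip (i + s) (i + j))          ≡⟨ rep j (<-≤-trans j<s (m≤m+n s t)) ⟩
      f (skip (i + s) (i + (s + t + j))) ≡⟨ after (s + t + j) (≤-trans (m≤m+n s t) (m≤m+n (s + t) j)) ⟩
      f (i + suc (s + t + j))           ∎
    swap : ∀ s t j → s + t + (s + j) ≡ s + (s + t + j)
    swap = solve-∀
    rep₂ : Repeats (shift (suc s) (shift i f)) (s + t) t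
    rep₂ j j<t = begin
      f (i + suc (s + j))                     ≡⟨ after (s + j) (m≤m+n s j) ⟨
      f (skip (i + s) (i + (s + j)))          ≡⟨ rep (s + j) (+-monoʳ-< s j<t) ⟩
      f (skip (i + s) (i + (s + t + (s + j)))) ≡⟨ after (s + t + (s + j)) (≤-trans (m≤m+n s t) (m≤m+n (s + t) (s + j))) ⟩
      f (i + suc (s + t + (s + j)))           ≡⟨ cong (λ n → f (i + suc n)) (swap s t j) ⟩
      f (i + suc (s + (s + t + j)))           ∎

  -- Here the gap lies `s` letters into the second half, so only the distance between the copies of
  -- the last `t` letters crosses it.
  skip-second : ∀ (f : ℕ → A) i s t → Repeats (shift i (f ∘ skip (i + (s + t + s)))) (s + t) (s + t) →
                NearSquareʳ (shift i f) s t
  skip-second f i s t rep = rep₁ , rep₂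
    where
    open ≡-Reasoning
    e : ℕ
    e = s + t + s
    before : ∀ j → j < e → f (skip (i + e) (i + j)) ≡ f (i + j)
    before j j<e = cong f (skip-< (+-monoʳ-< i j<e))
    after : ∀ j → e ≤ j → f (skip (i + e) (i + j)) ≡ f (i + suc j)
    after j e≤j = cong f (trans (skip-≥ (+-monoʳ-≤ i e≤j)) (sym (+-suc i j)))
    rep₁ : Repeats (shift i f) (s + t) s
    rep₁ j j<s = begin
      f (i + j)                          ≡⟨ before j (<-≤-trans j<s (m≤n+m s (s + t))) ⟨
      f (skip (i + e) (i + j))           ≡⟨ rep j (<-≤-trans j<s (m≤m+n s t)) ⟩
      f (skip (i + e) (i + (s + t + j))) ≡⟨ before (s + t + j) (+-monoʳ-< (s + t) j<s) ⟩
      f (i + (s + t + j))                ∎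
    swap : ∀ s t j → suc (s + t + (s + j)) ≡ s + (suc (s + t) + j)
    swap = solve-∀
    rep₂ : Repeats (shift s (shift i f)) (suc (s + t)) t
    rep₂ j j<t = begin
      f (i + (s + j))                          ≡⟨ before (s + j) (<-≤-trans (+-monoʳ-< s j<t) (m≤m+n (s + t) s)) ⟨
      f (skip (i + e) (i + (s + j)))           ≡⟨ rep (s + j) (+-monoʳ-< s j<t) ⟩
      f (skip (i + e) (i + (s + t + (s + j)))) ≡⟨ after (s + t + (s + j)) (+-monoʳ-≤ (s + t) (m≤m+n s j)) ⟩
      f (i + suc (s + t + (s + j)))            ≡⟨ cong (λ n → f (i + n)) (swap s t j) ⟩
      f (i + (s + (suc (s + t) + j)))          ∎

-- Deciding repetitions in finite words

module _ {A : Set} (_≟_ : DecidableEquality A) (e : A) where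

  -- Both lists are walked in step, so no letter is looked up from the start again; `drop 1` of an
  -- empty list is empty, which matches the junk letter past the end.
  agree? : ∀ xs ys m → Dec (Agree (at e xs) (at e ys) m)
  agree? xs ys zero    = yes λ _ ()
  agree? xs ys (suc m) = map′ to from ((at e xs 0 ≟ at e ys 0) ×-dec agree? (drop 1 xs) (drop 1 ys) m)
    where
    to : at e xs 0 ≡ at e ys 0 × Agree (at e (drop 1 xs)) (at e (drop 1 ys)) m →
         Agree (at e xs) (at e ys) (suc m)
    to (eq , eqs) zero    _         = eq
    to (eq , eqs) (suc j) (s≤s j<m) =
      trans (sym (at-drop e 1 xs j)) (trans (eqs j j<m) (at-drop e 1 ys j))
    from : Agree (at e xs) (at e ys) (suc m) →
           at e xs 0 ≡ at e ys 0 × Agree (at e (drop 1 xs)) (at e (drop 1 ys)) m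
    from eqs = eqs 0 z<s , λ j j<m →
      trans (at-drop e 1 xs j) (trans (eqs (suc j) (s<s j<m)) (sym (at-drop e 1 ys j)))

  repeats? : ∀ xs u d m → Dec (Repeats (shift u (at e xs)) d m)
  repeats? xs u d m = map′
    (λ eqs j j<m → trans (sym (first j)) (trans (eqs j j<m) (second j)))
    (λ eqs j j<m → trans (first j) (trans (eqs j j<m) (sym (second j))))
    (agree? (drop u xs) (drop d (drop u xs)) m)
    where
    first : ∀ j → at e (drop u xs) j ≡ at e xs (u + j)
    first = at-drop e u xs
    second : ∀ j → at e (drop d (drop u xs)) j ≡ at e xs (u + (d + j))
    second j = trans (at-drop e d (drop u xs) j) (at-drop e u xs (d + j))

  nearSquareˡ? : ∀ xs s t → Dec (NearSquareˡ (at e xs) s t)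
  nearSquareˡ? xs s t = repeats? xs 0 (suc (s + t)) s ×-dec repeats? xs (suc s) (s + t) t

  nearSquareʳ? : ∀ xs s t → Dec (NearSquareʳ (at e xs) s t)
  nearSquareʳ? xs s t = repeats? xs 0 (s + t) s ×-dec repeats? xs s (suc (s + t)) t

-- Conditions on a uniform morphism

-- Factors of length at most ℓ count as short. At the positions x₀ and x₁ of a block, which are
-- more than ℓ apart even cyclically, the letter determines the block.
record SteadyMorphism (A : Set) : Set where
  field
    seed      : A
    k ℓ x₀ x₁ : ℕ
    block     : A → Word A

  window : A → A → ℕ → ℕ → A
  window a b r = at seed (drop r (block a ++ block b))

  field
    length-block : ∀ a → length (block a) ≡ k
    seed-prefix  : at seed (block seed) 0 ≡ seed
    seed-next    : seed ≢ at seed (block seed) 1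
    1<k          : 1 < k
    0<ℓ          : 0 < ℓ
    4ℓ≤k         : ℓ + ℓ + (ℓ + ℓ) ≤ k
    x₁<k         : x₁ < k
    x₀≪x₁        : x₀ + suc ℓ ≤ x₁
    x₁≪x₀+k      : x₁ + suc ℓ ≤ x₀ + k
    x₀-injective : ∀ a b → at seed (block a) x₀ ≡ at seed (block b) x₀ → a ≡ b
    x₁-injective : ∀ a b → at seed (block a) x₁ ≡ at seed (block b) x₁ → a ≡ b
    synchronising : ∀ a b → a ≢ b → ∀ c d → c ≢ d → ∀ {r′} → r′ < k → ∀ {r} → r < r′ →
                    ¬ Agree (window a b r) (window c d r′) (suc ℓ)
    noShortˡ : ∀ a b → a ≢ b → ∀ {r} → r < k → ∀ {s} → s < suc ℓ → ∀ {t} → t < suc ℓ →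
               0 < s + t → ¬ NearSquareˡ (window a b r) s t
    noShortʳ : ∀ a b → a ≢ b → ∀ {r} → r < k → ∀ {s} → s < suc ℓ → ∀ {t} → t < suc ℓ →
               0 < s + t → ¬ NearSquareʳ (window a b r) s t

-- The fixed point and its windows

module FixedPoint {A : Set} (M : SteadyMorphism A) where
  open SteadyMorphism M

  instance
    k-nonZero : NonZero k
    k-nonZero = >-nonZero (<-trans z<s 1<k)

  -- The first argument bounds the recursion depth; depth n suffices at position n.
  approx : ℕ → ℕ → A
  approx zero    n = seed
  approx (suc f) n = at seed (block (approx f (n / k))) (n % k)

  w : ℕ → A
  w n = approx n n

  approx-0 : ∀ f → approx f 0 ≡ seed
  approx-0 zero = refl
  approx-0 (suc f)
    rewrite m<n⇒m/n≡0 {0} {k} (<-trans z<s 1<k) | m<n⇒m%n≡m {k} {0} (<-trans z<s 1<k) | approx-0 f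
    = seed-prefix

  n/k≤ : ∀ {f n} → n ≤ suc f → n / k ≤ f
  n/k≤ {f} {zero}  _  = ≤-trans (m/n≤m 0 k) z≤n
  n/k≤ {f} {suc n} n≤ = ≤-pred (≤-trans (m/n<m (suc n) k 1<k) n≤)

  -- Division by `k` strictly lowers a positive position, so depth `n` is enough to reach position
  -- 0; there every depth gives `seed`, by `seed-prefix`.
  approx-stable : ∀ f g n → n ≤ f → n ≤ g → approx f n ≡ approx g n
  approx-stable zero    g       .zero z≤n n≤g = sym (approx-0 g)
  approx-stable (suc f) zero    .zero n≤f z≤n = approx-0 (suc f)
  approx-stable (suc f) (suc g) n     n≤f n≤g =
    cong (λ a → at seed (block a) (n % k)) (approx-stable f g (n / k) (n/k≤ n≤f) (n/k≤ n≤g))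

  -- The fixed-point equation, obtained by unfolding one more level and lowering the depth with
  -- `approx-stable`.
  w-block : ∀ q {r} → r < k → w (r + q * k) ≡ at seed (block (w q)) r
  w-block q {r} r<k = begin
    approx n n                                   ≡⟨ approx-stable n (suc n) n ≤-refl (n≤1+n n) ⟩
    at seed (block (approx n (n / k))) (n % k)   ≡⟨ cong₂ (λ a → at seed (block (approx n a))) n/k n%k ⟩
    at seed (block (approx n q)) r               ≡⟨ cong (λ a → at seed (block a) r) (approx-stable n q q q≤n ≤-refl) ⟩
    at seed (block (w q)) r                      ∎
    where
    open ≡-Reasoning
    n : ℕ
    n = r + q * k
    n%k : n % k ≡ r
    n%k = trans ([m+kn]%n≡m%n r q k) (m<n⇒m%n≡m r<k)
    n/k : n / k ≡ q
    n/k = trans (+-distrib-/-∣ʳ r (divides q refl)) (cong₂ _+_ (m<n⇒m/n≡0 r<k) (m*n/n≡m q k))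
    q≤n : q ≤ n
    q≤n = ≤-trans (m≤m*n q k) (m≤n+m (q * k) r)

  w-window : ∀ n x → n % k + x < k + k → w (n + x) ≡ window (w (n / k)) (w (suc (n / k))) (n % k) x
  w-window n x y<2k = trans w≡ (sym (at-drop seed (n % k) (block (w q) ++ block (w (suc q))) x))
    where
    open ≡-Reasoning
    q y : ℕ
    q = n / k
    y = n % k + x
    n+x : n + x ≡ y + q * k
    n+x = begin
      n + x                ≡⟨ cong (_+ x) (m≡m%n+[m/n]*n n k) ⟩
      n % k + q * k + x    ≡⟨ +-assoc (n % k) (q * k) x ⟩
      n % k + (q * k + x)  ≡⟨ cong (n % k +_) (+-comm (q * k) x) ⟩
      n % k + (x + q * k)  ≡⟨ +-assoc (n % k) x (q * k) ⟨
      y + q * k            ∎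
    w≡ : w (n + x) ≡ at seed (block (w q) ++ block (w (suc q))) y
    w≡ with y <? k
    ... | yes y<k = begin
      w (n + x)                ≡⟨ cong w n+x ⟩
      w (y + q * k)            ≡⟨ w-block q y<k ⟩
      at seed (block (w q)) y  ≡⟨ at-++ˡ seed (block (w q)) _ (subst (y <_) (sym (length-block (w q))) y<k) ⟨
      at seed (block (w q) ++ block (w (suc q))) y ∎
    ... | no y≮k = begin
      w (n + x)                      ≡⟨ cong w n+x ⟩
      w (y + q * k)                  ≡⟨ cong (λ v → w (v + q * k)) y≡ ⟩
      w (k + z + q * k)              ≡⟨ cong w (trans (cong (_+ q * k) (+-comm k z)) (+-assoc z k (q * k))) ⟩
      w (z + suc q * k)              ≡⟨ w-block (suc q) z<k ⟩
      at seed (block (w (suc q))) z  ≡⟨ at-++ʳ seed (block (w q)) _ z ⟨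
      at seed (block (w q) ++ block (w (suc q))) (length (block (w q)) + z)
        ≡⟨ cong (λ v → at seed (block (w q) ++ block (w (suc q))) (v + z)) (length-block (w q)) ⟩
      at seed (block (w q) ++ block (w (suc q))) (k + z)
        ≡⟨ cong (at seed (block (w q) ++ block (w (suc q)))) y≡ ⟨
      at seed (block (w q) ++ block (w (suc q))) y ∎
      where
      z : ℕ
      z = y ∸ k
      y≡ : y ≡ k + z
      y≡ = sym (m+[n∸m]≡n (≮⇒≥ y≮k))
      z<k : z < k
      z<k = +-cancelˡ-< k z k (subst (_< k + k) y≡ y<2k)

  -- An offset `i % k` is at most `k ∸ 1`, so `k + 1` letters from it stay inside two blocks. With
  -- `4ℓ≤k` this covers every short near-square.
  agree-window : ∀ i → Agree (shift i w) (window (w (i / k)) (w (suc (i / k))) (i % k)) (suc k)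
  agree-window i x (s≤s x≤k) = w-window i x (+-mono-<-≤ (m%n<n i k) x≤k)

  agree-window-short : ∀ i {s t} → s ≤ ℓ → t ≤ ℓ →
    Agree (shift i w) (window (w (i / k)) (w (suc (i / k))) (i % k)) (suc (s + t + (s + t)))
  agree-window-short i {s} {t} s≤ℓ t≤ℓ j j< = agree-window i j (<-≤-trans j< (s≤s bound))
    where
    bound : s + t + (s + t) ≤ k
    bound = ≤-trans (+-mono-≤ (+-mono-≤ s≤ℓ t≤ℓ) (+-mono-≤ s≤ℓ t≤ℓ)) 4ℓ≤k

  -- The finite checks assume two distinct neighbouring letters, so this is proved by strong
  -- induction: the blocks around `i` come from positions `i / k` and its successor, which differ by
  -- induction, and an equal pair would be a square of period 1.
  w-adjacent : ∀ i → w i ≢ w (suc i)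
  w-adjacent = <-rec _ step
    where
    step : ∀ i → (∀ {q} → q < i → w q ≢ w (suc q)) → w i ≢ w (suc i)
    step zero    _  eq = seed-next (trans eq (w-block 0 1<k))
    step i@(suc _) ih eq =
      noShortʳ _ _ (ih (m/n<m i k 1<k)) (m%n<n i k) (s<s 0<ℓ) z<s z<s
        (nearSquareʳ-local 1 0 (agree-window-short i 0<ℓ z≤n) (rep , λ _ ()))
      where
      rep : Repeats (shift i w) 1 1
      rep zero    _ = trans (cong w (+-identityʳ i)) (trans eq (cong w (+-comm 1 i)))
      rep (suc j) (s≤s ())

  noShortˡ-w : ∀ i {s t} → s ≤ ℓ → t ≤ ℓ → 0 < s + t → ¬ NearSquareˡ (shift i w) s t
  noShortˡ-w i {s} {t} s≤ℓ t≤ℓ 0<s+t near =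
    noShortˡ _ _ (w-adjacent (i / k)) (m%n<n i k) (s≤s s≤ℓ) (s≤s t≤ℓ) 0<s+t
      (nearSquareˡ-local s t (agree-window-short i s≤ℓ t≤ℓ) near)

  noShortʳ-w : ∀ i {s t} → s ≤ ℓ → t ≤ ℓ → 0 < s + t → ¬ NearSquareʳ (shift i w) s t
  noShortʳ-w i {s} {t} s≤ℓ t≤ℓ 0<s+t near =
    noShortʳ _ _ (w-adjacent (i / k)) (m%n<n i k) (s≤s s≤ℓ) (s≤s t≤ℓ) 0<s+t
      (nearSquareʳ-local s t (agree-window-short i s≤ℓ t≤ℓ) near)

  -- Synchronisation and descent

  sync : ∀ {i i′} → Agree (shift i w) (shift i′ w) (suc ℓ) → ¬ (i % k < i′ % k)
  sync {i} {i′} agree r<r′ =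
    synchronising _ _ (w-adjacent (i / k)) _ _ (w-adjacent (i′ / k)) (m%n<n i′ k) r<r′
      λ j j≤ℓ → trans (sym (agree-window i j (long j≤ℓ))) (trans (agree j j≤ℓ) (agree-window i′ j (long j≤ℓ)))
    where
    ℓ<k : suc ℓ ≤ k
    ℓ<k = ≤-trans (m≤n+m (suc ℓ) x₀) (≤-trans x₀≪x₁ (<⇒≤ x₁<k))
    long : ∀ {j} → j < suc ℓ → j < suc k
    long j≤ℓ = <-≤-trans j≤ℓ (m≤n⇒m≤1+n ℓ<k)

  -- Both occurrences begin with the same `ℓ + 1` letters, so `sync`, used in both directions,
  -- forces equal residues modulo `k`.
  repeats⇒k∣period : ∀ i {d m} → ℓ < m → Repeats (shift i w) d m → k ∣ d
  repeats⇒k∣period i {d} {m} ℓ<m rep = divides (i′ / k ∸ i / k) (begin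
    d                                                ≡⟨ m+n∸m≡n i d ⟨
    i′ ∸ i                                           ≡⟨ cong₂ _∸_ (m≡m%n+[m/n]*n i′ k) (m≡m%n+[m/n]*n i k) ⟩
    i′ % k + i′ / k * k ∸ (i % k + i / k * k)        ≡⟨ cong (λ r → i′ % k + i′ / k * k ∸ (r + i / k * k)) same ⟩
    i′ % k + i′ / k * k ∸ (i′ % k + i / k * k)       ≡⟨ [m+n]∸[m+o]≡n∸o (i′ % k) (i′ / k * k) (i / k * k) ⟩
    i′ / k * k ∸ i / k * k                           ≡⟨ *-distribʳ-∸ k (i′ / k) (i / k) ⟨
    (i′ / k ∸ i / k) * k                             ∎)
    where
    open ≡-Reasoning
    i′ : ℕ
    i′ = i + d
    agree : Agree (shift i w) (shift i′ w) (suc ℓ)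
    agree j j≤ℓ = trans (rep j (<-≤-trans j≤ℓ ℓ<m)) (cong w (sym (+-assoc i d j)))
    same : i % k ≡ i′ % k
    same with <-cmp (i % k) (i′ % k)
    ... | tri< r<r′ _ _ = contradiction r<r′ (sync agree)
    ... | tri≈ _ r≡r′ _ = r≡r′
    ... | tri> _ _ r′<r = contradiction r′<r (sync λ j j≤ℓ → sym (agree j j≤ℓ))

  -- Reading w only at positions ≡ x (mod k), where the letter determines the block,
  -- turns a repetition whose period is a multiple of k into a square.
  desubstitute : ∀ {x} → x < k → (∀ a b → at seed (block a) x ≡ at seed (block b) x → a ≡ b) →
                 ∀ i a q {m} → q * k ≤ m + suc ℓ → i ≤ x + a * k → x + a * k + suc ℓ < i + k →
                 Repeats (shift i w) (q * k) m → Repeats (shift a w) q q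
  desubstitute {x} x<k x-inj i a q {m} qk≤ i≤ x≪ rep j j<q = x-inj _ _ (begin
    at seed (block (w (a + j))) x        ≡⟨ w-block (a + j) x<k ⟨
    w (x + (a + j) * k)                  ≡⟨ cong w (m+[n∸m]≡n i≤p) ⟨
    w (i + δ)                            ≡⟨ rep δ δ<m ⟩
    w (i + (q * k + δ))                  ≡⟨ cong w move ⟩
    w (x + (a + (q + j)) * k)            ≡⟨ w-block (a + (q + j)) x<k ⟩
    at seed (block (w (a + (q + j)))) x  ∎)
    where
    open ≡-Reasoning
    p δ : ℕ
    p = x + (a + j) * k
    δ = p ∸ i
    i≤p : i ≤ p
    i≤p = ≤-trans i≤ (+-monoʳ-≤ x (*-monoˡ-≤ k (m≤m+n a j)))
    ring₁ : ∀ i qk δ → i + (qk + δ) ≡ qk + (i + δ)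
    ring₁ = solve-∀
    ring₂ : ∀ x a j q k → q * k + (x + (a + j) * k) ≡ x + (a + (q + j)) * k
    ring₂ = solve-∀
    move : i + (q * k + δ) ≡ x + (a + (q + j)) * k
    move = trans (ring₁ i (q * k) δ) (trans (cong (q * k +_) (m+[n∸m]≡n i≤p)) (ring₂ x a j q k))
    ring₃ : ∀ x a j k → x + (a + j) * k + k ≡ x + a * k + suc j * k
    ring₃ = solve-∀
    ring₄ : ∀ u m l → u + (m + l) ≡ m + (u + l)
    ring₄ = solve-∀
    ring₅ : ∀ m i k → m + (i + k) ≡ i + m + k
    ring₅ = solve-∀
    -- Since `j < q`, `p + k` is at most `x + a * k + q * k`, hence at most
    -- `m + (x + a * k + suc ℓ)`; `x≪` bounds this strictly by `m + (i + k)`.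
    bound : p + k < i + m + k
    bound = subst (p + k <_) (ring₅ m i k) (≤-<-trans
      (≤-trans (≤-reflexive (ring₃ x a j k))
        (≤-trans (+-monoʳ-≤ (x + a * k) (≤-trans (*-monoˡ-≤ k j<q) qk≤))
          (≤-reflexive (ring₄ (x + a * k) m (suc ℓ)))))
      (+-monoʳ-< m x≪))
    δ<m : δ < m
    δ<m = +-cancelˡ-< i δ m (subst (_< i + m) (sym (m+[n∸m]≡n i≤p)) (+-cancelʳ-< k p (i + m) bound))

  x₀<k : x₀ < k
  x₀<k = ≤-<-trans (≤-trans (m≤m+n x₀ (suc ℓ)) x₀≪x₁) x₁<k

  module Residue (i : ℕ) where
    from : ∀ {y} → i % k ≤ y → i ≤ y + i / k * k
    from {y} r≤y = subst (_≤ y + i / k * k) (sym (m≡m%n+[m/n]*n i k)) (+-monoˡ-≤ (i / k * k) r≤y)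

    to : ∀ {y} → y + suc ℓ < i % k + k → y + i / k * k + suc ℓ < i + k
    to {y} y≪ = subst₂ _<_ (swap y (suc ℓ) (i / k * k))
      (trans (swap (i % k) k (i / k * k)) (cong (_+ k) (sym (m≡m%n+[m/n]*n i k))))
      (+-monoˡ-< (i / k * k) y≪)
      where
      swap : ∀ x y z → x + y + z ≡ x + z + y
      swap = solve-∀

  -- The repetition misses at most ℓ + 1 consecutive residues, hence not both x₀ and x₁.
  descent : ∀ i q {m} → q * k ≤ m + suc ℓ → Repeats (shift i w) (q * k) m →
            ∃[ a ] Repeats (shift a w) q q
  descent i q qk≤ rep with i % k ≤? x₀ | i % k ≤? x₁
  -- The reading position is the first of `x₀`, `x₁`, `x₀ + k` not below `i % k`. In each case the
  -- next one, or `k`, shows that more than `ℓ + 1` places remain before `i % k + k`.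
  ... | yes r≤x₀ | _ =
    i / k , desubstitute x₀<k x₀-injective i (i / k) q qk≤ (from r≤x₀) (to x₀≪r+k) rep
    where
    open Residue i
    x₀≪r+k : x₀ + suc ℓ < i % k + k
    x₀≪r+k = <-≤-trans (≤-<-trans x₀≪x₁ x₁<k) (m≤n+m k (i % k))
  ... | no r≰x₀ | yes r≤x₁ =
    i / k , desubstitute x₁<k x₁-injective i (i / k) q qk≤ (from r≤x₁) (to x₁≪r+k) rep
    where
    open Residue i
    x₁≪r+k : x₁ + suc ℓ < i % k + k
    x₁≪r+k = ≤-<-trans x₁≪x₀+k (+-monoˡ-< k (≰⇒> r≰x₀))
  ... | no r≰x₀ | no r≰x₁ =
    suc (i / k) , desubstitute x₀<k x₀-injective i (suc (i / k)) q qk≤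
      (subst (i ≤_) next (from r≤x₀+k)) (subst (λ p → p + suc ℓ < i + k) next (to x₀+k≪r+k)) rep
    where
    open Residue i
    next : x₀ + k + i / k * k ≡ x₀ + suc (i / k) * k
    next = +-assoc x₀ k (i / k * k)
    r≤x₀+k : i % k ≤ x₀ + k
    r≤x₀+k = ≤-trans (<⇒≤ (m%n<n i k)) (m≤n+m k x₀)
    swap : ∀ x y z → x + y + z ≡ x + z + y
    swap = solve-∀
    x₀+k≪r+k : x₀ + k + suc ℓ < i % k + k
    x₀+k≪r+k = subst (_< i % k + k) (swap x₀ (suc ℓ) k) (+-monoˡ-< k (≤-<-trans x₀≪x₁ (≰⇒> r≰x₁)))

  -- The gap between the occurrences is at most `ℓ + 1`: synchronisation makes the period `q * k`,
  -- and `descent` leaves a square of period `q`.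
  long-descent : ∀ i {d m} → 0 < d → ℓ < m → d ≤ m + suc ℓ → Repeats (shift i w) d m →
                 ∃[ q ] ∃[ a ] (0 < q × q < d × Repeats (shift a w) q q)
  long-descent i 0<d ℓ<m d≤ rep with repeats⇒k∣period i ℓ<m rep
  ... | divides (suc q) refl =
    let a , sq = descent i (suc q) d≤ rep in suc q , a , z<s , m<m*n (suc q) k 1<k , sq
  ... | divides zero refl = contradiction 0<d λ ()

  -- Excluding squares and near-squares

  w-squareFree : ∀ p → 0 < p → ∀ i → ¬ Repeats (shift i w) p p
  w-squareFree = <-rec _ step
    where
    step : ∀ p → (∀ {q} → q < p → 0 < q → ∀ i → ¬ Repeats (shift i w) q q) →
           0 < p → ∀ i → ¬ Repeats (shift i w) p p
    step p ih 0<p i rep with p ≤? ℓ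
    -- A short square is the near-square with `t = 0`; longer ones descend to a smaller period.
    ... | yes p≤ℓ = noShortʳ-w i p≤ℓ z≤n (subst (0 <_) p≡p+0 0<p)
                      (subst (λ d → Repeats (shift i w) d p) p≡p+0 rep , λ _ ())
      where
      p≡p+0 : p ≡ p + 0
      p≡p+0 = sym (+-identityʳ p)
    ... | no p≰ℓ =
      let q , a , 0<q , q<p , sq = long-descent i 0<p (≰⇒> p≰ℓ) (m≤m+n p (suc ℓ)) rep in ih q<p 0<q a sq

  noLongRepeat : ∀ i {d m} → 0 < d → ℓ < m → d ≤ m + suc ℓ → ¬ Repeats (shift i w) d m
  noLongRepeat i 0<d ℓ<m d≤ rep =
    let q , a , 0<q , _ , sq = long-descent i 0<d ℓ<m d≤ rep in w-squareFree q 0<q a sq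

  -- Settles the case where both parts are long: their distances `s + t` and `s + t + 1` would both
  -- be multiples of `k`.
  k∤consecutive : ∀ n → k ∣ n → ¬ (k ∣ suc n)
  k∤consecutive n k∣n k∣1+n =
    <-irrefl (sym (∣1⇒≡1 (∣m+n∣m⇒∣n (subst (k ∣_) (+-comm 1 n) k∣1+n) k∣n))) 1<k

  w-noNearSquareˡ : ∀ i {s t} → 0 < s + t → ¬ NearSquareˡ (shift i w) s t
  w-noNearSquareˡ i {s} {t} 0<s+t near@(rep₁ , rep₂) with s ≤? ℓ | t ≤? ℓ
  ... | yes s≤ℓ | yes t≤ℓ = noShortˡ-w i s≤ℓ t≤ℓ 0<s+t near
  -- The copies of the long part are separated by the deleted letter and the short part, at most
  -- `ℓ + 1` letters; hence the slack `suc ℓ`.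
  ... | no s≰ℓ  | yes t≤ℓ =
    noLongRepeat i z<s (≰⇒> s≰ℓ) (subst (_≤ s + suc ℓ) (+-suc s t) (+-monoʳ-≤ s (s≤s t≤ℓ))) rep₁
  ... | yes s≤ℓ | no t≰ℓ  =
    noLongRepeat (i + suc s) 0<s+t (≰⇒> t≰ℓ)
      (subst (_≤ t + suc ℓ) (+-comm t s) (+-monoʳ-≤ t (m≤n⇒m≤1+n s≤ℓ))) (repeats-shift w i (suc s) (s + t) rep₂)
  ... | no s≰ℓ  | no t≰ℓ  =
    k∤consecutive (s + t) (repeats⇒k∣period (i + suc s) (≰⇒> t≰ℓ) (repeats-shift w i (suc s) (s + t) rep₂))
                          (repeats⇒k∣period i (≰⇒> s≰ℓ) rep₁)

  w-noNearSquareʳ : ∀ i {s t} → 0 < s + t → ¬ NearSquareʳ (shift i w) s t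
  w-noNearSquareʳ i {s} {t} 0<s+t near@(rep₁ , rep₂) with s ≤? ℓ | t ≤? ℓ
  ... | yes s≤ℓ | yes t≤ℓ = noShortʳ-w i s≤ℓ t≤ℓ 0<s+t near
  ... | no s≰ℓ  | yes t≤ℓ =
    noLongRepeat i 0<s+t (≰⇒> s≰ℓ) (+-monoʳ-≤ s (m≤n⇒m≤1+n t≤ℓ)) rep₁
  ... | yes s≤ℓ | no t≰ℓ  =
    noLongRepeat (i + s) z<s (≰⇒> t≰ℓ)
      (subst (_≤ t + suc ℓ) (+-comm t (suc s)) (+-monoʳ-≤ t (s≤s s≤ℓ))) (repeats-shift w i s (suc (s + t)) rep₂)
  ... | no s≰ℓ  | no t≰ℓ  =
    k∤consecutive (s + t) (repeats⇒k∣period i (≰⇒> s≰ℓ) rep₁)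
                          (repeats⇒k∣period (i + s) (≰⇒> t≰ℓ) (repeats-shift w i s (suc (s + t)) rep₂))

  -- Four places for the deleted position: at or before the start (a square of `w` one place later),
  -- `s ≤ p` letters in (left near-square), `p + u` letters in with `u ≤ p` (right near-square), or
  -- beyond (the square is already in `w`).
  noSquare-skip : ∀ e i {p} → 0 < p → ¬ Repeats (shift i (w ∘ skip e)) p p
  noSquare-skip e i {p} 0<p rep with e ≤? i
  ... | yes e≤i = w-squareFree p 0<p (suc i) λ j j<p →
    trans (cong w (sym (skip-≥ (≤-trans e≤i (m≤m+n i j)))))
      (trans (rep j j<p) (cong w (skip-≥ (≤-trans e≤i (m≤m+n i (p + j))))))
  ... | no e≰i with m≤n⇒∃[o]m+o≡n (<⇒≤ (≰⇒> e≰i))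
  ...   | s , refl with s ≤? p
  ...     | yes s≤p with m≤n⇒∃[o]m+o≡n s≤p
  ...       | t , refl = w-noNearSquareˡ i 0<p (skip-first w i s t rep)
  noSquare-skip e i {p} 0<p rep | no e≰i | s , refl | no s≰p with m≤n⇒∃[o]m+o≡n (<⇒≤ (≰⇒> s≰p))
  ...       | u , refl with u ≤? p
  ...         | yes u≤p with m≤n⇒∃[o]m+o≡n u≤p
  ...           | t , refl = w-noNearSquareʳ i 0<p (skip-second w i u t rep)
  noSquare-skip e i {p} 0<p rep | no e≰i | s , refl | no s≰p | u , refl | no u≰p =
    w-squareFree p 0<p i λ j j<p →
      trans (cong w (sym (skip-< (+-monoʳ-< i (<-≤-trans j<p (m≤m+n p u))))))
        (trans (rep j j<p) (cong w (skip-< (+-monoʳ-< i (+-monoʳ-< p (<-trans j<p (≰⇒> u≰p)))))))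

  steady-prefix : ∀ n → Steady (applyUpTo w n)
  steady-prefix n =
    squareFree-applyUpTo (λ i {p} 0<p → w-squareFree p 0<p i) n ,
    λ i → subst SquareFree (sym (removeAt-applyUpTo w n i))
            (squareFree-applyUpTo (noSquare-skip (toℕ i)) (pred n))

-- The explicit morphism and its finite checks

block : Fin 4 → Word (Fin 4)
block 0F =
  3F ∷ 1F ∷ 2F ∷ 0F ∷ 1F ∷ 3F ∷ 2F ∷ 1F ∷ 0F ∷ 2F ∷ 3F ∷ 0F ∷ 1F ∷ 3F ∷ 2F ∷ 0F ∷ 3F ∷ 1F ∷ 2F ∷ 3F ∷ 0F ∷ 1F ∷ 3F ∷ 2F ∷ 1F ∷
  0F ∷ 2F ∷ 3F ∷ 0F ∷ 1F ∷ 2F ∷ 0F ∷ 3F ∷ 1F ∷ 0F ∷ 2F ∷ 1F ∷ 3F ∷ 0F ∷ 1F ∷ 2F ∷ 3F ∷ 1F ∷ 0F ∷ 3F ∷ 2F ∷ 1F ∷ 3F ∷ 0F ∷ 2F ∷ []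
block 1F =
  3F ∷ 1F ∷ 2F ∷ 0F ∷ 1F ∷ 3F ∷ 2F ∷ 1F ∷ 0F ∷ 3F ∷ 1F ∷ 2F ∷ 3F ∷ 0F ∷ 2F ∷ 1F ∷ 0F ∷ 3F ∷ 2F ∷ 0F ∷ 1F ∷ 3F ∷ 0F ∷ 2F ∷ 3F ∷
  1F ∷ 2F ∷ 0F ∷ 3F ∷ 2F ∷ 1F ∷ 0F ∷ 2F ∷ 3F ∷ 1F ∷ 2F ∷ 0F ∷ 1F ∷ 3F ∷ 0F ∷ 2F ∷ 3F ∷ 1F ∷ 0F ∷ 3F ∷ 2F ∷ 1F ∷ 3F ∷ 0F ∷ 2F ∷ []
block 2F =
  3F ∷ 1F ∷ 2F ∷ 0F ∷ 1F ∷ 3F ∷ 2F ∷ 1F ∷ 0F ∷ 3F ∷ 1F ∷ 2F ∷ 3F ∷ 0F ∷ 1F ∷ 3F ∷ 2F ∷ 0F ∷ 3F ∷ 1F ∷ 0F ∷ 2F ∷ 3F ∷ 0F ∷ 1F ∷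
  2F ∷ 0F ∷ 3F ∷ 2F ∷ 1F ∷ 3F ∷ 0F ∷ 1F ∷ 2F ∷ 3F ∷ 1F ∷ 0F ∷ 2F ∷ 1F ∷ 3F ∷ 0F ∷ 1F ∷ 2F ∷ 0F ∷ 3F ∷ 2F ∷ 1F ∷ 3F ∷ 0F ∷ 2F ∷ []
block 3F =
  3F ∷ 1F ∷ 2F ∷ 0F ∷ 1F ∷ 3F ∷ 0F ∷ 2F ∷ 1F ∷ 0F ∷ 3F ∷ 2F ∷ 0F ∷ 1F ∷ 2F ∷ 3F ∷ 0F ∷ 2F ∷ 1F ∷ 3F ∷ 2F ∷ 0F ∷ 3F ∷ 1F ∷ 0F ∷
  2F ∷ 3F ∷ 0F ∷ 1F ∷ 3F ∷ 2F ∷ 1F ∷ 0F ∷ 3F ∷ 1F ∷ 2F ∷ 0F ∷ 1F ∷ 3F ∷ 0F ∷ 2F ∷ 3F ∷ 1F ∷ 0F ∷ 3F ∷ 2F ∷ 1F ∷ 3F ∷ 0F ∷ 2F ∷ []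

window : Fin 4 → Fin 4 → ℕ → Word (Fin 4)
window a b r = drop r (block a ++ block b)

abstract
  -- Only `r < r′` is tested; the opposite order follows by exchanging the two windows.
  block-synchronising : ∀ a b → a ≢ b → ∀ c d → c ≢ d → ∀ {r′} → r′ < 50 → ∀ {r} → r < r′ →
                        ¬ Agree (at 3F (window a b r)) (at 3F (window c d r′)) 13
  block-synchronising = toWitness {a? =
    all? λ a → all? λ b → ¬? (a Fin.≟ b) →-dec all? λ c → all? λ d → ¬? (c Fin.≟ d) →-dec
    allUpTo? (λ r′ → allUpTo? (λ r → ¬? (agree? Fin._≟_ 3F (window a b r) (window c d r′) 13)) r′) 50} _

  -- At most 49 letters are read from an offset of at most 49, so the junk letter past position 99
  -- is never met.
  block-noShortˡ : ∀ a b → a ≢ b → ∀ {r} → r < 50 → ∀ {s} → s < 13 → ∀ {t} → t < 13 →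
                   0 < s + t → ¬ NearSquareˡ (at 3F (window a b r)) s t
  block-noShortˡ = toWitness {a? =
    all? λ a → all? λ b → ¬? (a Fin.≟ b) →-dec allUpTo? (λ r → allUpTo? (λ s → allUpTo? (λ t →
    0 <? s + t →-dec ¬? (nearSquareˡ? Fin._≟_ 3F (window a b r) s t)) 13) 13) 50} _

  block-noShortʳ : ∀ a b → a ≢ b → ∀ {r} → r < 50 → ∀ {s} → s < 13 → ∀ {t} → t < 13 →
                   0 < s + t → ¬ NearSquareʳ (at 3F (window a b r)) s t
  block-noShortʳ = toWitness {a? =
    all? λ a → all? λ b → ¬? (a Fin.≟ b) →-dec allUpTo? (λ r → allUpTo? (λ s → allUpTo? (λ t →
    0 <? s + t →-dec ¬? (nearSquareʳ? Fin._≟_ 3F (window a b r) s t)) 13) 13) 50} _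

steadyMorphism : SteadyMorphism (Fin 4)
steadyMorphism = record
  -- Every block starts with `3F`, which forces the seed. `ℓ = 12` is the largest value with
  -- `4ℓ ≤ 50`. The four blocks carry 1, 3, 0, 2 at position 17 and 3, 2, 1, 0 at position 32; the
  -- cyclic distances are 15 and 35, both at least 13.
  { seed = 3F ; k = 50 ; ℓ = 12 ; x₀ = 17 ; x₁ = 32
  ; block         = block
  ; length-block  = from-yes (all? λ a → length (block a) ≟ 50)
  ; seed-prefix   = refl
  ; seed-next     = λ ()
  ; 1<k           = from-yes (1 <? 50)
  ; 0<ℓ           = from-yes (0 <? 12)
  ; 4ℓ≤k          = from-yes (48 ≤? 50)
  ; x₁<k          = from-yes (32 <? 50)
  ; x₀≪x₁         = from-yes (30 ≤? 32)
  ; x₁≪x₀+k       = from-yes (45 ≤? 67)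
  ; x₀-injective  = from-yes (all? λ a → all? λ b → (at 3F (block a) 17 Fin.≟ at 3F (block b) 17) →-dec (a Fin.≟ b))
  ; x₁-injective  = from-yes (all? λ a → all? λ b → (at 3F (block a) 32 Fin.≟ at 3F (block b) 32) →-dec (a Fin.≟ b))
  ; synchronising = block-synchronising
  ; noShortˡ      = block-noShortˡ
  ; noShortʳ      = block-noShortʳ
  }

mainTheorem1 : (n : ℕ) → n ≥ 1 → Σ[ W ∈ Word (Fin 4) ] (Steady W × length W ≥ n)
mainTheorem1 n _ = applyUpTo w n , steady-prefix n , ≤-reflexive (sym (length-applyUpTo w n))
  where open FixedPoint steadyMorphism
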